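{- Let $m\in\mathbb N$, let $M_1,M_2\in{\rm Mat}_m(\mathbb Z)$, and let $S\in{\rm Mat}_m(\mathbb Z)\cap GL_m(\mathbb Q)$ satisfy $M_2=S^{ -1}M_1S$. Then for every $n\in\mathbb N$ with $\gcd(n,\det(S))=1$, the move graphs $\Gamma_{M_1,\,n}$ and $\Gamma_{M_2,\,n}$ are isomorphic.
   Context: $\mathbb N$ is the set of positive integers and $\mathbb Z_n$ the integers modulo $n$. $GL_m(\mathbb Q)$ denotes the invertible $m\times m$ rational matrices. For $M\in{\rm Mat}_m(\mathbb Z)$, the move graph $\Gamma_{M,\,n}$ is the directed graph with vertex set $\mathbb Z_n^m$ and arc set $\{({\bf x},{\bf y}) : {\bf y}^T=M{\bf x}^T \text{ in } \mathbb Z_n^m\}$ (loops allowed). -}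

module Defs where

open import Algebra.Bundles using (CommutativeRing)
import Algebra.Definitions as AlgebraicDefinitions
import Algebra.Properties.Monoid.Sum as Sum
import Algebra.Properties.Semiring.Exp as Exp
open import Data.Bool.Base using (if_then_else_)
open import Data.Fin.Base using (Fin; zero; suc; toℕ)
open import Data.Fin.Properties using (_≟_)
open import Data.Integer.Base as ℤ using (ℤ; +_)
open import Data.Integer.Divisibility.Signed
  using (_∣_; ∣m∣n⇒∣m+n; ∣m⇒∣-m; ∣n⇒∣m*n; divides)
import Data.Integer.Properties as ℤ
open import Data.Integer.Tactic.RingSolver using (solve-∀)
open import Data.Nat.Base using (ℕ; zero; suc)
open import Data.Product.Base using (_,_)
open import Data.Rational.Base using (ℚ; _/_)
import Data.Rational.Properties as ℚ
open import Data.Vec.Functional using (Vector; removeAt)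
import Data.Vec.Functional.Relation.Binary.Equality.Setoid as VectorEquality
open import Function.Bundles using (Bijection; _⇔_)
open import Level using (Level; 0ℓ; _⊔_) renaming (suc to lsuc)
open import Relation.Binary.Bundles using (Setoid)
open import Relation.Binary.Core using (Rel)
open import Relation.Binary.Definitions using (_Respects₂_)
open import Relation.Binary.PropositionalEquality.Core
  using (_≡_; refl; subst)
open import Relation.Nullary.Decidable.Core using (does)

Matrix : ∀ {a} → Set a → ℕ → Set a
Matrix A m = Vector (Vector A m) m

module MatrixAlgebra {c ℓ : Level} (R : CommutativeRing c ℓ) where
  open CommutativeRing R hiding (zero) renaming (Carrier to A)
  open Exp semiring using (_^_)
  open Sum +-monoid using (sum)

  infix  4 _≈ᴹ_
  infixl 7 _*ᴹ_ _*ᵛ_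

  _≈ᴹ_ : ∀ {m} → Rel (Matrix A m) ℓ
  P ≈ᴹ Q = ∀ i j → P i j ≈ Q i j

  1ᴹ : ∀ {m} → Matrix A m
  1ᴹ i j = if does (i ≟ j) then 1# else 0#

  _*ᴹ_ : ∀ {m} → Matrix A m → Matrix A m → Matrix A m
  (P *ᴹ Q) i j = sum λ k → P i k * Q k j

  _*ᵛ_ : ∀ {m} → Matrix A m → Vector A m → Vector A m
  (P *ᵛ x) i = sum λ k → P i k * x k

  -- Laplace expansion along the first row.
  det : ∀ {m} → Matrix A m → A
  det {zero}  P = 1#
  det {suc m} P = sum λ j →
    (- 1#) ^ toℕ j * P zero j * det (λ i → removeAt (P (suc i)) j)

  GL : ∀ {m} → Matrix A m → Set (c ⊔ ℓ)
  GL = AlgebraicDefinitions.Invertible _≈ᴹ_ 1ᴹ _*ᴹ_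

module Matℤ = MatrixAlgebra ℤ.+-*-commutativeRing
module Matℚ = MatrixAlgebra ℚ.+-*-commutativeRing

toℚᴹ : ∀ {m} → Matrix ℤ m → Matrix ℚ m
toℚᴹ P i j = P i j / 1

-- A record rather than a synonym, so that x and y can be inferred from
-- the type of a congruence.
record _≡_[mod_] (x y : ℤ) (n : ℕ) : Set where
  constructor congruent
  field
    divides-difference : + n ∣ x ℤ.- y

-- The quotient ring ℤ/nℤ as a setoid: its elements are represented by
-- integers and its equality is congruence modulo n.
ℤmod : ℕ → CommutativeRing 0ℓ 0ℓ
ℤmod n = record
  { Carrier = ℤ
  ; _≈_     = _≈_
  ; _+_     = ℤ._+_
  ; _*_     = ℤ._*_
  ; -_      = ℤ.-_
  ; 0#      = ℤ.0ℤ
  ; 1#      = ℤ.1ℤ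
  ; isCommutativeRing = record
    { isRing = record
      { +-isAbelianGroup = record
        { isGroup = record
          { isMonoid = record
            { isSemigroup = record
              { isMagma = record
                { isEquivalence = record
                  { refl  = reflexive refl
                  ; sym   = ≈-sym
                  ; trans = ≈-trans
                  }
                ; ∙-cong = +-cong
                }
              ; assoc = λ x y z → reflexive (ℤ.+-assoc x y z)
              }
            ; identity = (λ x → reflexive (ℤ.+-identityˡ x))
                       , (λ x → reflexive (ℤ.+-identityʳ x))
            }
          ; inverse = (λ x → reflexive (ℤ.+-inverseˡ x))
                    , (λ x → reflexive (ℤ.+-inverseʳ x))
          ; ⁻¹-cong = neg-cong
          }
        ; comm = λ x y → reflexive (ℤ.+-comm x y)
        }
      ; *-cong = *-cong
      ; *-assoc = λ x y z → reflexive (ℤ.*-assoc x y z)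
      ; *-identity = (λ x → reflexive (ℤ.*-identityˡ x))
                   , (λ x → reflexive (ℤ.*-identityʳ x))
      ; distrib = (λ x y z → reflexive (ℤ.*-distribˡ-+ x y z))
                , (λ x y z → reflexive (ℤ.*-distribʳ-+ x y z))
      }
    ; *-comm = λ x y → reflexive (ℤ.*-comm x y)
    }
  }
  where
  _≈_ : Rel ℤ 0ℓ
  x ≈ y = x ≡ y [mod n ]

  reflexive : ∀ {x y} → x ≡ y → x ≈ y
  reflexive {x} refl = congruent (divides ℤ.0ℤ (ℤ.+-inverseʳ x))

  ≈-sym : ∀ {x y} → x ≈ y → y ≈ x
  ≈-sym {x} {y} (congruent p) =
    congruent (subst (+ n ∣_) (identity x y) (∣m⇒∣-m p))
    where
    identity : ∀ x y → ℤ.- (x ℤ.- y) ≡ y ℤ.- x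
    identity = solve-∀

  ≈-trans : ∀ {x y z} → x ≈ y → y ≈ z → x ≈ z
  ≈-trans {x} {y} {z} (congruent p) (congruent q) =
    congruent (subst (+ n ∣_) (identity x y z) (∣m∣n⇒∣m+n p q))
    where
    identity : ∀ x y z → (x ℤ.- y) ℤ.+ (y ℤ.- z) ≡ x ℤ.- z
    identity = solve-∀

  +-cong : ∀ {x y u v} → x ≈ y → u ≈ v → (x ℤ.+ u) ≈ (y ℤ.+ v)
  +-cong {x} {y} {u} {v} (congruent p) (congruent q) =
    congruent (subst (+ n ∣_) (identity x y u v) (∣m∣n⇒∣m+n p q))
    where
    identity : ∀ x y u v →
      (x ℤ.- y) ℤ.+ (u ℤ.- v) ≡ (x ℤ.+ u) ℤ.- (y ℤ.+ v)
    identity = solve-∀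

  neg-cong : ∀ {x y} → x ≈ y → (ℤ.- x) ≈ (ℤ.- y)
  neg-cong {x} {y} (congruent p) =
    congruent (subst (+ n ∣_) (identity x y) (∣m⇒∣-m p))
    where
    identity : ∀ x y → ℤ.- (x ℤ.- y) ≡ (ℤ.- x) ℤ.- (ℤ.- y)
    identity = solve-∀

  *-cong : ∀ {x y u v} → x ≈ y → u ≈ v → (x ℤ.* u) ≈ (y ℤ.* v)
  *-cong {x} {y} {u} {v} (congruent p) (congruent q) =
    congruent (subst (+ n ∣_) (identity x y u v)
      (∣m∣n⇒∣m+n (∣n⇒∣m*n u p) (∣n⇒∣m*n y q)))
    where
    identity : ∀ x y u v →
      u ℤ.* (x ℤ.- y) ℤ.+ y ℤ.* (u ℤ.- v) ≡ x ℤ.* u ℤ.- y ℤ.* v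
    identity = solve-∀

record Digraph (a ℓ r : Level) : Set (lsuc (a ⊔ ℓ ⊔ r)) where
  field
    vertices : Setoid a ℓ

  open Setoid vertices public using (_≈_) renaming (Carrier to Vertex)

  field
    Arc      : Rel Vertex r
    Arc-resp : Arc Respects₂ _≈_

module _ {a ℓ r a′ ℓ′ r′ : Level} where
  record _≅_ (G : Digraph a ℓ r) (H : Digraph a′ ℓ′ r′) :
             Set (a ⊔ ℓ ⊔ r ⊔ a′ ⊔ ℓ′ ⊔ r′) where
    private
      module G = Digraph G
      module H = Digraph H
    field
      bijection : Bijection G.vertices H.vertices

    open Bijection bijection public using (to)

    field
      arcs : ∀ x y → G.Arc x y ⇔ H.Arc (to x) (to y)

  infix 4 _≅_

-- An integer represents its own residue class, so M is also the
-- reduction of M modulo n.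
moveGraph : ∀ {m} → Matrix ℤ m → ℕ → Digraph 0ℓ 0ℓ 0ℓ
moveGraph {m} M n = record
  { vertices = ≋-setoid m
  ; Arc      = λ x y → y ≋ M *ᵛ x
  ; Arc-resp = (λ y≈y′ y≈Mx i → trans (≈-sym (y≈y′ i)) (y≈Mx i))
             , (λ x≈x′ y≈Mx i → trans (y≈Mx i)
                 (sum-cong-≋ λ k → *-congˡ {M i k} (x≈x′ k)))
  }
  where
  open CommutativeRing (ℤmod n)
    using (setoid; trans; +-monoid; *-congˡ) renaming (sym to ≈-sym)
  open VectorEquality setoid using (_≋_; ≋-setoid)
  open MatrixAlgebra (ℤmod n) using (_*ᵛ_)
  open Sum +-monoid using (sum-cong-≋)

{-# OPTIONS --safe #-}

-- Over ℤ the adjugate T of S satisfies S T = d I with d = det S, because the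
-- determinant is alternating in the rows; since S is invertible over ℚ it can be
-- cancelled from S (T S) = d S = S (d I), so T S = d I as well. Choosing u with
-- u d ≡ 1 modulo n makes A = u T an inverse of S modulo n. The hypothesis says
-- S M₂ = M₁ S over ℤ, whence A M₁ ≡ M₂ A modulo n, and x ↦ A x is the isomorphism.

module Submission where

open import Defs
open import Algebra.Bundles using (CommutativeRing; Monoid)
import Algebra.Properties.CommutativeMonoid.Sum as CommutativeMonoidSum
import Algebra.Properties.Monoid as MonoidProperties
import Algebra.Properties.Monoid.Sum as MonoidSum
import Algebra.Properties.Semiring.Exp as SemiringExp
import Algebra.Properties.Semiring.Sum as SemiringSum
open import Data.Fin.Base using (Fin; zero; suc; toℕ; punchIn; punchOut; lift)
open import Data.Fin.Properties using (_≟_; punchIn-punchOut)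
open import Data.Integer.Base using (ℤ; +_; -[1+_]; 0ℤ; 1ℤ; -1ℤ; ∣_∣)
open import Data.Integer.Divisibility.Signed using (divides)
open import Data.Integer.GCD using (gcd)
import Data.Integer.Properties as ℤ
open import Data.Integer.Tactic.RingSolver using (solve-∀)
open import Data.Nat.Base as ℕ using (ℕ; NonZero; zero; suc)
open import Data.Nat.Coprimality using (coprime-Bézout; gcd≡1⇒coprime)
open import Data.Nat.GCD using (module Bézout)
open import Data.Product.Base using (_,_; proj₁; ∃)
open import Data.Rational.Base as ℚ using (_/_)
import Data.Rational.Properties as ℚ
open import Data.Rational.Unnormalised.Base as ℚᵘ using (mkℚᵘ; *≡*)
import Data.Rational.Unnormalised.Properties as ℚᵘ
open import Data.Vec.Functional using (Vector; _∷_; tail; removeAt)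
import Data.Vec.Functional.Relation.Binary.Equality.Setoid as VectorEquality
open import Function.Base using (_∘_)
open import Function.Bundles using (mk⇔)
open import Function.Properties.Inverse using (Inverse⇒Bijection)
open import Level using (Level)
open import Relation.Binary.Bundles using (Setoid)
open import Relation.Binary.PropositionalEquality.Core as ≡ using (_≡_; _≗_)
open import Relation.Binary.PropositionalEquality.Properties
  using (module ≡-Reasoning)
import Relation.Binary.Reasoning.Setoid as SetoidReasoning
open import Relation.Nullary using (yes; no)

-- Matrices over a commutative ring.

module MatrixProperties {c ℓ : Level} (R : CommutativeRing c ℓ) where
  open CommutativeRing R hiding (zero) renaming (Carrier to A)
  open MatrixAlgebra R
  open VectorEquality setoid using (_≋_; ≋-setoid)
  open CommutativeMonoidSum +-commutativeMonoid
    using (sum; sum-cong-≋; sum-replicate-zero; ∑-comm)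
  open SemiringSum semiring using (*-distribˡ-sum; *-distribʳ-sum)
  open SetoidReasoning setoid

  *ᵛ-congˡ : ∀ {m} (P : Matrix A m) {x y} → x ≋ y → P *ᵛ x ≋ P *ᵛ y
  *ᵛ-congˡ P x≈y i = sum-cong-≋ λ k → *-congˡ (x≈y k)

  *ᵛ-congʳ : ∀ {m} {P Q : Matrix A m} x → P ≈ᴹ Q → P *ᵛ x ≋ Q *ᵛ x
  *ᵛ-congʳ x P≈Q i = sum-cong-≋ λ k → *-congʳ (P≈Q i k)

  *ᵛ-assoc : ∀ {m} (P Q : Matrix A m) x → (P *ᴹ Q) *ᵛ x ≋ P *ᵛ (Q *ᵛ x)
  *ᵛ-assoc P Q x i = begin
    (sum λ k → (sum λ l → P i l * Q l k) * x k)
      ≈⟨ (sum-cong-≋ λ k → *-distribʳ-sum (x k) (λ l → P i l * Q l k)) ⟩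
    (sum λ k → sum λ l → P i l * Q l k * x k)
      ≈⟨ ∑-comm (λ k l → P i l * Q l k * x k) ⟩
    (sum λ l → sum λ k → P i l * Q l k * x k)
      ≈⟨ (sum-cong-≋ λ l → trans
           (sum-cong-≋ λ k → *-assoc (P i l) (Q l k) (x k))
           (sym (*-distribˡ-sum (P i l) (λ k → Q l k * x k)))) ⟩
    (sum λ l → P i l * (sum λ k → Q l k * x k)) ∎

  *ᵛ-identityˡ : ∀ {m} (x : Vector A m) → 1ᴹ *ᵛ x ≋ x
  *ᵛ-identityˡ {suc m} x zero = begin
    1# * x zero + (sum λ k → 0# * x (suc k))
      ≈⟨ +-cong (*-identityˡ _)
           (trans (sum-cong-≋ λ k → zeroˡ (x (suc k))) (sum-replicate-zero m)) ⟩
    x zero + 0#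
      ≈⟨ +-identityʳ _ ⟩
    x zero ∎
  *ᵛ-identityˡ x (suc i) = begin
    0# * x zero + (sum λ k → 1ᴹ i k * x (suc k))
      ≈⟨ +-cong (zeroˡ _) (*ᵛ-identityˡ (λ k → x (suc k)) i) ⟩
    0# + x (suc i)
      ≈⟨ +-identityˡ _ ⟩
    x (suc i) ∎

  1ᴹ-sym : ∀ {m} (i j : Fin m) → 1ᴹ i j ≈ 1ᴹ j i
  1ᴹ-sym zero    zero    = refl
  1ᴹ-sym zero    (suc j) = refl
  1ᴹ-sym (suc i) zero    = refl
  1ᴹ-sym (suc i) (suc j) = 1ᴹ-sym i j

  -- By commutativity and the symmetry of `1ᴹ`, row `i` of the product is `1ᴹ *ᵛ P i`, so the left
  -- unit law applies.
  *ᴹ-identityʳ : ∀ {m} (P : Matrix A m) → P *ᴹ 1ᴹ ≈ᴹ P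
  *ᴹ-identityʳ P i j = trans
    (sum-cong-≋ λ k → trans (*-comm (P i k) (1ᴹ k j)) (*-congʳ (1ᴹ-sym k j)))
    (*ᵛ-identityˡ (P i) j)

  *ᴹ-monoid : ℕ → Monoid c ℓ
  *ᴹ-monoid m = record
    { Carrier  = Matrix A m
    ; _≈_      = _≈ᴹ_
    ; _∙_      = _*ᴹ_
    ; ε        = 1ᴹ
    ; isMonoid = record
      { isSemigroup = record
        { isMagma = record
          { isEquivalence = Setoid.isEquivalence
              (VectorEquality.≋-setoid (≋-setoid m) m)
          ; ∙-cong = λ {P} {P′} {Q} {Q′} P≈P′ Q≈Q′ i j →
              sum-cong-≋ λ k → *-cong (P≈P′ i k) (Q≈Q′ k j)
          }
        -- The left factors act on each column of the right factor separately.
        ; assoc = λ P Q S i j → *ᵛ-assoc P Q (λ k → S k j) i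
        }
      ; identity = (λ P i j → *ᵛ-identityˡ (λ k → P k j) i)
                 , *ᴹ-identityʳ
      }
    }

  infixr 8 _·ᴹ_
  _·ᴹ_ : ∀ {m} → A → Matrix A m → Matrix A m
  (x ·ᴹ P) i j = x * P i j

  ·ᴹ-*ᴹ : ∀ {m} x (P Q : Matrix A m) → (x ·ᴹ P) *ᴹ Q ≈ᴹ x ·ᴹ (P *ᴹ Q)
  ·ᴹ-*ᴹ x P Q i j = trans
    (sum-cong-≋ λ k → *-assoc x (P i k) (Q k j))
    (sym (*-distribˡ-sum x λ k → P i k * Q k j))

  *ᴹ-·ᴹ : ∀ {m} x (P Q : Matrix A m) → P *ᴹ (x ·ᴹ Q) ≈ᴹ x ·ᴹ (P *ᴹ Q)
  *ᴹ-·ᴹ x P Q i j = trans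
    (sum-cong-≋ λ k → begin
      P i k * (x * Q k j) ≈⟨ *-assoc (P i k) x (Q k j) ⟨
      P i k * x * Q k j   ≈⟨ *-congʳ (*-comm (P i k) x) ⟩
      x * P i k * Q k j   ≈⟨ *-assoc x (P i k) (Q k j) ⟩
      x * (P i k * Q k j) ∎)
    (sym (*-distribˡ-sum x λ k → P i k * Q k j))

module _ {c ℓ} (M : Monoid c ℓ) where
  open Monoid M using (_∙_; _≈_; ε; setoid; assoc; ∙-congˡ; ∙-congʳ)
  open MonoidProperties M using (cancelˡ; insertʳ)
  open SetoidReasoning setoid

  -- `s ∙ a` is inserted on the right, the hypothesis moves `s` next to the left `a`, and `a ∙ s`
  -- cancels. With `a` inverse to `S` modulo n, this turns `S M₂ = M₁ S` around.
  inverse-intertwines : ∀ {s a x y} → s ∙ a ≈ ε → a ∙ s ≈ ε →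
    s ∙ y ≈ x ∙ s → a ∙ x ≈ y ∙ a
  inverse-intertwines {s} {a} {x} {y} sa≈ε as≈ε sy≈xs = begin
    a ∙ x             ≈⟨ insertʳ sa≈ε (a ∙ x) ⟩
    a ∙ x ∙ s ∙ a     ≈⟨ ∙-congʳ (assoc a x s) ⟩
    a ∙ (x ∙ s) ∙ a   ≈⟨ ∙-congʳ (∙-congˡ sy≈xs) ⟨
    a ∙ (s ∙ y) ∙ a   ≈⟨ ∙-congʳ (cancelˡ as≈ε y) ⟩
    y ∙ a             ∎

open import Data.Integer.Base using (_+_; _*_; -_; _-_)
open ≡ using (refl; sym; trans; cong; cong₂)

private
  module ℤᴹ = MatrixProperties ℤ.+-*-commutativeRing
  module ℚᴹ = MatrixProperties ℚ.+-*-commutativeRing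

-- Integer determinants: alternation and the adjugate.

module _ where
  open MonoidSum ℤ.+-0-monoid using (sum; sum-cong-≗; sum-replicate-zero)
  open SemiringSum ℤ.+-*-semiring using (*-distribˡ-sum)
  open SemiringExp ℤ.+-*-semiring using (_^_)
  open CommutativeMonoidSum ℤ.+-0-commutativeMonoid using (∑-distrib-+)
  open Matℤ
  open ℤᴹ using (_·ᴹ_)
  open ≡-Reasoning

  sum-zero : ∀ {n} {f : Vector ℤ n} → f ≗ (λ _ → 0ℤ) → sum f ≡ 0ℤ
  sum-zero {n} f≗0 = trans (sum-cong-≗ f≗0) (sum-replicate-zero n)

  *-distribˡ-sum-cong : ∀ {n} x {f g : Vector ℤ n} →
    (∀ i → f i ≡ x * g i) → sum f ≡ x * sum g
  *-distribˡ-sum-cong x {g = g} f≗xg =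
    trans (sum-cong-≗ f≗xg) (sym (*-distribˡ-sum x g))

  sign : ∀ {n} → Fin n → ℤ
  sign i = -1ℤ ^ toℕ i

  sign-suc : ∀ {n} (i : Fin n) → sign (suc i) ≡ - sign i
  sign-suc i = ℤ.-1*i≡-i (sign i)

  sign² : ∀ {n} (i : Fin n) → sign i * sign i ≡ 1ℤ
  sign² zero    = refl
  sign² (suc i) rewrite sign-suc i = trans (identity (sign i)) (sign² i)
    where
    identity : ∀ s → - s * - s ≡ s * s
    identity = solve-∀

  det-cong : ∀ {m} (P Q : Matrix ℤ m) → P ≈ᴹ Q → det P ≡ det Q
  det-cong {zero}  P Q P≈Q = refl
  det-cong {suc m} P Q P≈Q = sum-cong-≗ λ j → cong₂ _*_
    (cong (sign j *_) (P≈Q zero j))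
    (det-cong _ _ λ i k → P≈Q (suc i) (punchIn j k))

  -- The Laplace expansion along two rows v and w: a map f selects the columns
  -- of a complementary minor, whose value is G f.
  expansion₂ : ∀ {n} (v w : Vector ℤ (suc (suc n))) →
    ((Fin n → Fin (suc (suc n))) → ℤ) → ℤ
  expansion₂ v w G = sum λ j → sign j * v j *
    (sum λ k → sign k * w (punchIn j k) * G (λ l → punchIn j (punchIn k l)))

  -- Column maps built in different ways agree only pointwise, so `G` has to respect pointwise
  -- equality.
  Congruent : ∀ {m n} → ((Fin m → Fin n) → ℤ) → Set
  Congruent G = ∀ f g → f ≗ g → G f ≡ G g

  -- The summands of expansion₂ are indexed by pairs of distinct columns. Those
  -- with column zero form the boundary, which is antisymmetric on sight; the
  -- others form the interior, an expansion of the same kind with v and w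
  -- replaced by their tails.
  private
    module _ {n} (G : (Fin n → Fin (suc (suc n))) → ℤ) where
      boundary : Vector ℤ (suc (suc n)) → ℤ
      boundary w = sum λ k → sign k * w (suc k) * G (suc ∘ punchIn k)

      interior : (v w : Vector ℤ (suc (suc n))) → ℤ
      interior v w = sum λ j → sign (suc j) * v (suc j) *
        (sum λ k → sign (suc k) * w (suc (punchIn j k)) *
          G (punchIn (suc j) ∘ punchIn (suc k)))

      expansion₂-split : ∀ v w → expansion₂ v w G ≡
        v zero * boundary w + - (w zero * boundary v) + interior v w
      expansion₂-split v w = begin
        1ℤ * v zero * boundary w + sum (λ j → s j * (e j + i j))
          ≡⟨ cong (λ x → 1ℤ * v zero * boundary w + x) (trans
               (sum-cong-≗ λ j → ℤ.*-distribˡ-+ (s j) (e j) (i j))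
               (∑-distrib-+ (λ j → s j * e j) (λ j → s j * i j))) ⟩
        1ℤ * v zero * boundary w + (sum (λ j → s j * e j) + interior v w)
          -- The summand `s j * e j` belongs to the pair (`suc j`, `zero`), where `w` takes column
          -- zero. The minus sign comes from `sign (suc j)`.
          ≡⟨ cong (λ x → 1ℤ * v zero * boundary w + (x + interior v w))
               (*-distribˡ-sum-cong (- w zero) λ j → trans
                 (cong (λ x → x * v (suc j) * e j) (sign-suc j))
                 (edge (sign j) (v (suc j)) (w zero) (G (suc ∘ punchIn j)))) ⟩
        1ℤ * v zero * boundary w + (- w zero * boundary v + interior v w)
          ≡⟨ collect (v zero) (boundary w) (w zero) (boundary v) (interior v w) ⟩
        v zero * boundary w + - (w zero * boundary v) + interior v w ∎
        where
        s e i : Vector ℤ (suc n)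
        s j = sign (suc j) * v (suc j)
        e j = 1ℤ * w zero * G (suc ∘ punchIn j)
        i j = sum λ k → sign (suc k) * w (suc (punchIn j k)) *
          G (punchIn (suc j) ∘ punchIn (suc k))
        edge : ∀ s v w g → - s * v * (1ℤ * w * g) ≡ - w * (s * v * g)
        edge = solve-∀
        collect : ∀ a b c d e →
          1ℤ * a * b + (- c * d + e) ≡ a * b + - (c * d) + e
        collect = solve-∀

    punchIn-lift : ∀ {n} (j : Fin (suc (suc n))) k →
      punchIn (suc j) ∘ punchIn (suc k) ≗ lift 1 (punchIn j ∘ punchIn k)
    punchIn-lift j k zero    = refl
    punchIn-lift j k (suc l) = refl

    -- Each of the two indices is a successor, so two minus signs arise and cancel. Column zero is
    -- taken by neither `v` nor `w`, hence stays in the minor as its first column; `lift 1` records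
    -- this.
    interior-shift : ∀ {n} (G : (Fin (suc n) → Fin (suc (suc (suc n)))) → ℤ) →
      Congruent G → ∀ v w →
      interior G v w ≡ expansion₂ (tail v) (tail w) (G ∘ lift 1)
    interior-shift G G-cong v w = sum-cong-≗ λ j → begin
      sign (suc j) * v (suc j) * (sum λ k →
        sign (suc k) * w (suc (punchIn j k)) * G (punchIn (suc j) ∘ punchIn (suc k)))
        ≡⟨ cong₂ _*_ (cong (_* v (suc j)) (sign-suc j))
             (*-distribˡ-sum-cong -1ℤ λ k → trans
               (cong₂ (λ s g → s * w (suc (punchIn j k)) * g)
                 (sign-suc k)
                 (G-cong _ _ (punchIn-lift j k)))
               (neg (sign k) (w (suc (punchIn j k))) _)) ⟩
      - sign j * v (suc j) * (-1ℤ * inner j)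
        ≡⟨ neg² (sign j) (v (suc j)) (inner j) ⟩
      sign j * v (suc j) * inner j ∎
      where
      inner : _ → ℤ
      inner j = sum λ k → sign k * w (suc (punchIn j k)) *
        G (lift 1 (punchIn j ∘ punchIn k))
      neg : ∀ s w g → - s * w * g ≡ -1ℤ * (s * w * g)
      neg = solve-∀
      neg² : ∀ s v x → - s * v * (-1ℤ * x) ≡ s * v * x
      neg² = solve-∀

  -- Induction on the number of columns: exchanging `v` and `w` exchanges the two boundary terms,
  -- which carry opposite signs, and the interior is an expansion with one column fewer.
  expansion₂-antisym : ∀ {n} (G : (Fin n → Fin (suc (suc n))) → ℤ) →
    Congruent G → ∀ v w → expansion₂ v w G ≡ - expansion₂ w v G
  expansion₂-antisym {n} G G-cong v w = begin
    expansion₂ v w G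
      ≡⟨ expansion₂-split G v w ⟩
    v zero * boundary G w + - (w zero * boundary G v) + interior G v w
      ≡⟨ cong (λ x → v zero * boundary G w + - (w zero * boundary G v) + x)
           (interior-antisym G G-cong v w) ⟩
    v zero * boundary G w + - (w zero * boundary G v) + - interior G w v
      ≡⟨ flip (v zero * boundary G w) (w zero * boundary G v) (interior G w v) ⟩
    - (w zero * boundary G v + - (v zero * boundary G w) + interior G w v)
      ≡⟨ cong -_ (expansion₂-split G w v) ⟨
    - expansion₂ w v G ∎
    where
    flip : ∀ a b c → a + - b + - c ≡ - (b + - a + c)
    flip = solve-∀

    interior-antisym : ∀ {n} (G : (Fin n → Fin (suc (suc n))) → ℤ) →
      Congruent G → ∀ v w → interior G v w ≡ - interior G w v
    -- With two columns in all, no pair of distinct columns avoids column zero, so every inner sum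
    -- is empty.
    interior-antisym {zero} G G-cong v w = trans
      (sum-zero λ j → ℤ.*-zeroʳ (sign (suc j) * v (suc j)))
      (cong -_ (sym (sum-zero λ j → ℤ.*-zeroʳ (sign (suc j) * w (suc j)))))
    interior-antisym {suc n} G G-cong v w = begin
      interior G v w
        ≡⟨ interior-shift G G-cong v w ⟩
      expansion₂ (tail v) (tail w) (G ∘ lift 1)
        ≡⟨ expansion₂-antisym (G ∘ lift 1)
             (λ f g f≗g → G-cong _ _ λ { zero → refl ; (suc l) → cong suc (f≗g l) })
             (tail v) (tail w) ⟩
      - expansion₂ (tail w) (tail v) (G ∘ lift 1)
        ≡⟨ cong -_ (interior-shift G G-cong w v) ⟨
      - interior G w v ∎

  -- Unfolding `det` twice gives literally `expansion₂` of the first two rows, with `G` the minor of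
  -- the remaining rows on the selected columns.
  det-swap : ∀ {m} (P : Matrix ℤ (suc (suc m))) →
    det P ≡ - det (P (suc zero) ∷ P zero ∷ tail (tail P))
  det-swap P = expansion₂-antisym (λ f → det λ i l → P (suc (suc i)) (f l))
    (λ f g f≗g → det-cong _ _ λ i l → cong (P (suc (suc i))) (f≗g l))
    (P zero) (P (suc zero))

  -- For nonzero `i` the two sides have different constructors. The implication fails modulo 2, a
  -- reason to study determinants over the integers before reducing.
  i≡-i⇒i≡0 : ∀ {i} → i ≡ - i → i ≡ 0ℤ
  i≡-i⇒i≡0 {+ zero} _ = refl

  -- If the equal rows are the first two, swapping them fixes `P` and negates the determinant.
  -- Otherwise the swap puts the old second row on top, and every minor in the expansion along it
  -- still contains both equal rows, the first of them on top.
  det-alternating : ∀ {m} (P : Matrix ℤ (suc m)) i →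
    P zero ≗ P (suc i) → det P ≡ 0ℤ
  det-alternating {suc m} P zero P₀≗P₁ = i≡-i⇒i≡0 (trans (det-swap P)
    (cong -_ (det-cong (P (suc zero) ∷ P zero ∷ tail (tail P)) P λ
      { zero          k → sym (P₀≗P₁ k)
      ; (suc zero)    k → P₀≗P₁ k
      ; (suc (suc i)) k → refl
      })))
  det-alternating {suc (suc m)} P (suc i) P₀≗Pᵢ =
    trans (det-swap P) (cong -_ (sum-zero λ j → trans
      (cong (sign j * P (suc zero) j *_)
        (det-alternating (minor j) i λ k → P₀≗Pᵢ (punchIn j k)))
      (ℤ.*-zeroʳ (sign j * P (suc zero) j))))
    where
    minor : Fin (suc (suc (suc m))) → Matrix ℤ (suc (suc m))
    minor j k = removeAt ((P zero ∷ tail (tail P)) k) j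

  toFront : ∀ {a} {A : Set a} {n} → Fin (suc n) → Vector A (suc n) → Vector A (suc n)
  toFront i xs = xs i ∷ removeAt xs i

  -- Row `suc i` reaches the front by moving to second place, inside each minor of the expansion
  -- along `P zero`, and then by one swap with `P zero`.
  det-toFront : ∀ {m} i (P : Matrix ℤ (suc m)) →
    det (toFront i P) ≡ sign i * det P
  det-toFront zero P = trans
    (det-cong (toFront zero P) P λ { zero k → refl ; (suc i) k → refl })
    (sym (ℤ.*-identityˡ (det P)))
  det-toFront {suc m} (suc i) P = begin
    det (toFront (suc i) P)
      ≡⟨ det-swap (toFront (suc i) P) ⟩
    - (sum λ j → sign j * P zero j * det (minor′ j))
      ≡⟨ cong -_ (*-distribˡ-sum-cong (sign i) λ j → begin
           sign j * P zero j * det (minor′ j)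
             ≡⟨ cong (sign j * P zero j *_) (trans
                  (det-cong (minor′ j) (toFront i (minor j))
                    λ { zero k → refl ; (suc l) k → refl })
                  (det-toFront i (minor j))) ⟩
           sign j * P zero j * (sign i * det (minor j))
             ≡⟨ exchange (sign j * P zero j) (sign i) (det (minor j)) ⟩
           sign i * (sign j * P zero j * det (minor j)) ∎) ⟩
    - (sign i * det P)
      ≡⟨ ℤ.neg-distribˡ-* (sign i) (det P) ⟩
    - sign i * det P
      ≡⟨ cong (_* det P) (sign-suc i) ⟨
    sign (suc i) * det P ∎
    where
    minor minor′ : Fin (suc (suc m)) → Matrix ℤ (suc m)
    minor  j k = removeAt (P (suc k)) j
    minor′ j k = removeAt ((P (suc i) ∷ (λ l → P (suc (punchIn i l)))) k) j
    exchange : ∀ a b c → a * (b * c) ≡ b * (a * c)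
    exchange = solve-∀

  -- The transposed cofactor matrix. The sign is kept as two factors: `sign j` serves the Laplace
  -- summand and `sign i` comes out of the sum.
  adjugate : ∀ {m} → Matrix ℤ m → Matrix ℤ m
  adjugate {suc m} P j i =
    sign i * (sign j * det (λ k → removeAt (removeAt P i k) j))

  -- Up to `sign i`, the entry is the expansion of `P` with row `i` deleted and row `k` put on top.
  -- For `k` equal to `i` this is `toFront i P`; otherwise row `k` occurs twice.
  *-adjugate : ∀ {m} (P : Matrix ℤ m) → P *ᴹ adjugate P ≈ᴹ det P ·ᴹ 1ᴹ
  *-adjugate {suc m} P k i = begin
    (sum λ j → P k j * (sign i * (sign j * minor j)))
      ≡⟨ *-distribˡ-sum-cong (sign i) (λ j →
           exchange (P k j) (sign i) (sign j) (minor j)) ⟩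
    sign i * det (P k ∷ removeAt P i)
      ≡⟨ row k ⟩
    det P * 1ᴹ k i ∎
    where
    minor : Fin (suc m) → ℤ
    minor j = det λ l → removeAt (removeAt P i l) j
    exchange : ∀ a b c d → a * (b * (c * d)) ≡ b * (c * a * d)
    exchange = solve-∀
    row : ∀ k → sign i * det (P k ∷ removeAt P i) ≡ det P * 1ᴹ k i
    -- This decision also defines `1ᴹ k i`, which therefore evaluates in each branch.
    row k with k ≟ i
    ... | yes refl = begin
      sign i * det (toFront i P) ≡⟨ cong (sign i *_) (det-toFront i P) ⟩
      sign i * (sign i * det P)  ≡⟨ ℤ.*-assoc (sign i) (sign i) (det P) ⟨
      sign i * sign i * det P    ≡⟨ cong (_* det P) (sign² i) ⟩
      1ℤ * det P                 ≡⟨ ℤ.*-comm 1ℤ (det P) ⟩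
      det P * 1ℤ                 ∎
    ... | no k≢i = begin
      sign i * det (P k ∷ removeAt P i)
        ≡⟨ cong (sign i *_) (det-alternating (P k ∷ removeAt P i)
             (punchOut (k≢i ∘ sym))
             λ l → cong (λ k → P k l) (sym (punchIn-punchOut (k≢i ∘ sym)))) ⟩
      sign i * 0ℤ ≡⟨ ℤ.*-zeroʳ (sign i) ⟩
      0ℤ          ≡⟨ ℤ.*-zeroʳ (det P) ⟨
      det P * 0ℤ  ∎

-- The embedding of the integers into the rationals.

/1-injective : ∀ {i j} → i / 1 ≡ j / 1 → i ≡ j
/1-injective {i} {j} i/1≡j/1
  -- `mkℚᵘ` stores the denominator minus one, so the 0 stands for denominator 1.
  with ℚ.fromℚᵘ-injective {mkℚᵘ i 0} {mkℚᵘ j 0} i/1≡j/1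
... | *≡* i*1≡j*1 = ℤ.*-cancelʳ-≡ i j 1ℤ i*1≡j*1

-- Arithmetic in `ℚ` reduces fractions by a gcd. On unnormalised fractions only a ring identity
-- remains.
/1-homo-+ : ∀ i j → (i + j) / 1 ≡ i / 1 ℚ.+ j / 1
/1-homo-+ i j = ℚ.toℚᵘ-injective (begin
  ℚ.toℚᵘ ((i + j) / 1)                 ≈⟨ ℚ.toℚᵘ-fromℚᵘ (mkℚᵘ (i + j) 0) ⟩
  mkℚᵘ (i + j) 0                       ≈⟨ *≡* (identity i j) ⟩
  mkℚᵘ i 0 ℚᵘ.+ mkℚᵘ j 0
    ≈⟨ ℚᵘ.+-cong (ℚ.toℚᵘ-fromℚᵘ (mkℚᵘ i 0)) (ℚ.toℚᵘ-fromℚᵘ (mkℚᵘ j 0)) ⟨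
  ℚ.toℚᵘ (i / 1) ℚᵘ.+ ℚ.toℚᵘ (j / 1)   ≈⟨ ℚ.toℚᵘ-homo-+ (i / 1) (j / 1) ⟨
  ℚ.toℚᵘ (i / 1 ℚ.+ j / 1)             ∎)
  where
  open SetoidReasoning ℚᵘ.≃-setoid
  identity : ∀ i j → (i + j) * 1ℤ ≡ (i * 1ℤ + j * 1ℤ) * 1ℤ
  identity = solve-∀

/1-homo-* : ∀ i j → (i * j) / 1 ≡ (i / 1) ℚ.* (j / 1)
/1-homo-* i j = ℚ.toℚᵘ-injective (begin
  ℚ.toℚᵘ ((i * j) / 1)                 ≈⟨ ℚ.toℚᵘ-fromℚᵘ (mkℚᵘ (i * j) 0) ⟩
  mkℚᵘ i 0 ℚᵘ.* mkℚᵘ j 0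
    ≈⟨ ℚᵘ.*-cong (ℚ.toℚᵘ-fromℚᵘ (mkℚᵘ i 0)) (ℚ.toℚᵘ-fromℚᵘ (mkℚᵘ j 0)) ⟨
  ℚ.toℚᵘ (i / 1) ℚᵘ.* ℚ.toℚᵘ (j / 1)   ≈⟨ ℚ.toℚᵘ-homo-* (i / 1) (j / 1) ⟨
  ℚ.toℚᵘ ((i / 1) ℚ.* (j / 1))         ∎)
  where open SetoidReasoning ℚᵘ.≃-setoid

module _ where
  open MonoidSum ℤ.+-0-monoid using () renaming (sum to sumℤ)
  open MonoidSum ℚ.+-0-monoid using (sum-cong-≗) renaming (sum to sumℚ)
  open Matℚ

  /1-homo-sum : ∀ {n} (f : Vector ℤ n) → sumℤ f / 1 ≡ sumℚ (λ i → f i / 1)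
  /1-homo-sum {zero}  f = refl
  /1-homo-sum {suc n} f = trans (/1-homo-+ (f zero) (sumℤ (tail f)))
    (cong (f zero / 1 ℚ.+_) (/1-homo-sum (tail f)))

  toℚᴹ-cong : ∀ {m} {P Q : Matrix ℤ m} → P Matℤ.≈ᴹ Q → toℚᴹ P ≈ᴹ toℚᴹ Q
  toℚᴹ-cong P≈Q i j = cong (_/ 1) (P≈Q i j)

  toℚᴹ-injective : ∀ {m} {P Q : Matrix ℤ m} → toℚᴹ P ≈ᴹ toℚᴹ Q → P Matℤ.≈ᴹ Q
  toℚᴹ-injective P≈Q i j = /1-injective (P≈Q i j)

  toℚᴹ-homo-* : ∀ {m} (P Q : Matrix ℤ m) →
    toℚᴹ (P Matℤ.*ᴹ Q) ≈ᴹ toℚᴹ P *ᴹ toℚᴹ Q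
  toℚᴹ-homo-* P Q i j = trans (/1-homo-sum λ k → P i k * Q k j)
    (sum-cong-≗ λ k → /1-homo-* (P i k) (Q k j))

  module _ {m : ℕ} where
    open Monoid (ℚᴹ.*ᴹ-monoid m) using (setoid; ∙-congˡ; assoc)
    open MonoidProperties (ℚᴹ.*ᴹ-monoid m) using (insertˡ; cancelˡ)
    open SetoidReasoning setoid

    -- `S` may have no integral inverse, so the cancellation takes place over `ℚ` and injectivity of
    -- the embedding brings it back.
    *ᴹ-cancelˡ : ∀ (S P Q : Matrix ℤ m) → GL (toℚᴹ S) →
      S Matℤ.*ᴹ P Matℤ.≈ᴹ S Matℤ.*ᴹ Q → P Matℤ.≈ᴹ Q
    *ᴹ-cancelˡ S P Q (S⁻¹ , S⁻¹S≈1 , _) SP≈SQ = toℚᴹ-injective (begin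
      toℚᴹ P
        ≈⟨ insertˡ {S⁻¹} {toℚᴹ S} S⁻¹S≈1 (toℚᴹ P) ⟩
      S⁻¹ *ᴹ (toℚᴹ S *ᴹ toℚᴹ P)
        ≈⟨ ∙-congˡ {S⁻¹} (toℚᴹ-homo-* S P) ⟨
      S⁻¹ *ᴹ toℚᴹ (S Matℤ.*ᴹ P)
        ≈⟨ ∙-congˡ {S⁻¹} (toℚᴹ-cong SP≈SQ) ⟩
      S⁻¹ *ᴹ toℚᴹ (S Matℤ.*ᴹ Q)
        ≈⟨ ∙-congˡ {S⁻¹} (toℚᴹ-homo-* S Q) ⟩
      S⁻¹ *ᴹ (toℚᴹ S *ᴹ toℚᴹ Q)
        ≈⟨ cancelˡ {S⁻¹} {toℚᴹ S} S⁻¹S≈1 (toℚᴹ Q) ⟩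
      toℚᴹ Q ∎)

    -- Clearing `S⁻¹` leaves an equation between integer matrices, which can be reduced modulo n.
    conjugate⇒intertwines : ∀ (M₁ M₂ S : Matrix ℤ m) (S∈GL : GL (toℚᴹ S)) →
      toℚᴹ M₂ ≈ᴹ (proj₁ S∈GL *ᴹ toℚᴹ M₁) *ᴹ toℚᴹ S →
      S Matℤ.*ᴹ M₂ Matℤ.≈ᴹ M₁ Matℤ.*ᴹ S
    conjugate⇒intertwines M₁ M₂ S (S⁻¹ , _ , SS⁻¹≈1) M₂≈S⁻¹M₁S =
      toℚᴹ-injective (begin
        toℚᴹ (S Matℤ.*ᴹ M₂)
          ≈⟨ toℚᴹ-homo-* S M₂ ⟩
        toℚᴹ S *ᴹ toℚᴹ M₂
          ≈⟨ ∙-congˡ {toℚᴹ S} M₂≈S⁻¹M₁S ⟩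
        toℚᴹ S *ᴹ ((S⁻¹ *ᴹ toℚᴹ M₁) *ᴹ toℚᴹ S)
          ≈⟨ ∙-congˡ {toℚᴹ S} (assoc S⁻¹ (toℚᴹ M₁) (toℚᴹ S)) ⟩
        toℚᴹ S *ᴹ (S⁻¹ *ᴹ (toℚᴹ M₁ *ᴹ toℚᴹ S))
          ≈⟨ cancelˡ {toℚᴹ S} {S⁻¹} SS⁻¹≈1 (toℚᴹ M₁ *ᴹ toℚᴹ S) ⟩
        toℚᴹ M₁ *ᴹ toℚᴹ S
          ≈⟨ toℚᴹ-homo-* M₁ S ⟨
        toℚᴹ (M₁ Matℤ.*ᴹ S) ∎)

adjugate-* : ∀ {m} (S : Matrix ℤ m) → Matℚ.GL (toℚᴹ S) →
  adjugate S Matℤ.*ᴹ S Matℤ.≈ᴹ Matℤ.det S ℤᴹ.·ᴹ Matℤ.1ᴹ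
adjugate-* {m} S S∈GL = *ᴹ-cancelˡ S (T *ᴹ S) (d ·ᴹ 1ᴹ) S∈GL (begin
  S *ᴹ (T *ᴹ S)    ≈⟨ assoc S T S ⟨
  (S *ᴹ T) *ᴹ S    ≈⟨ ∙-congʳ {S} (*-adjugate S) ⟩
  (d ·ᴹ 1ᴹ) *ᴹ S   ≈⟨ ·ᴹ-*ᴹ d 1ᴹ S ⟩
  d ·ᴹ (1ᴹ *ᴹ S)   ≈⟨ (λ i j → cong (d *_) (ε-comm S i j)) ⟨
  d ·ᴹ (S *ᴹ 1ᴹ)   ≈⟨ *ᴹ-·ᴹ d S 1ᴹ ⟨
  S *ᴹ (d ·ᴹ 1ᴹ)   ∎)
  where
  open Matℤ using (_*ᴹ_; 1ᴹ; det)
  open ℤᴹ using (_·ᴹ_; ·ᴹ-*ᴹ; *ᴹ-·ᴹ)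
  open Monoid (ℤᴹ.*ᴹ-monoid m) using (setoid; assoc; ∙-congʳ)
  open MonoidProperties (ℤᴹ.*ᴹ-monoid m) using (ε-comm)
  open SetoidReasoning setoid
  T = adjugate S
  d = det S

-- Inverting the determinant modulo n.

∣i∣≡u*i : ∀ i → ∃ λ u → + ∣ i ∣ ≡ u * i
∣i∣≡u*i (+ n)    = 1ℤ , sym (ℤ.*-identityˡ (+ n))
∣i∣≡u*i -[1+ n ] = -1ℤ , sym (ℤ.-1*i≡-i -[1+ n ])

-- Bézout over `ℕ` avoids subtraction, so it yields one of two equations, and it concerns `∣ d ∣`.
-- The sign `u` carries it to `d`; the inverse is `+ y * u` or `- + y * u` according to the side on
-- which `∣ d ∣` stands.
coprime⇒invertible : ∀ n d → gcd (+ n) d ≡ 1ℤ → ∃ λ u → (u * d) ≡ 1ℤ [mod n ]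
coprime⇒invertible n d gcd≡1
  with coprime-Bézout (gcd≡1⇒coprime (ℤ.+-injective gcd≡1)) | ∣i∣≡u*i d
... | Bézout.-+ x y 1+xn≡y∣d∣ | u , ∣d∣≡ud =
  + y * u , congruent (divides (+ x) (begin
    + y * u * d - 1ℤ          ≡⟨ cong (_- 1ℤ) (ℤ.*-assoc (+ y) u d) ⟩
    + y * (u * d) - 1ℤ        ≡⟨ cong (λ z → + y * z - 1ℤ) ∣d∣≡ud ⟨
    + y * + ∣ d ∣ - 1ℤ        ≡⟨ cong (_- 1ℤ) (ℤ.pos-* y ∣ d ∣) ⟨
    + (y ℕ.* ∣ d ∣) - 1ℤ      ≡⟨ cong (λ z → + z - 1ℤ) 1+xn≡y∣d∣ ⟨
    1ℤ + + (x ℕ.* n) - 1ℤ     ≡⟨ cong (λ z → 1ℤ + z - 1ℤ) (ℤ.pos-* x n) ⟩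
    1ℤ + + x * + n - 1ℤ       ≡⟨ identity (+ x) (+ n) ⟩
    + x * + n                 ∎))
  where
  open ≡-Reasoning
  identity : ∀ x n → 1ℤ + x * n - 1ℤ ≡ x * n
  identity = solve-∀
... | Bézout.+- x y 1+y∣d∣≡xn | u , ∣d∣≡ud =
  - + y * u , congruent (divides (- + x) (begin
    - + y * u * d - 1ℤ        ≡⟨ identity (+ y) u d ⟩
    - (1ℤ + + y * (u * d))    ≡⟨ cong (λ z → - (1ℤ + + y * z)) ∣d∣≡ud ⟨
    - (1ℤ + + y * + ∣ d ∣)    ≡⟨ cong (λ z → - (1ℤ + z)) (ℤ.pos-* y ∣ d ∣) ⟨
    - (+ (1 ℕ.+ y ℕ.* ∣ d ∣)) ≡⟨ cong (λ z → - + z) 1+y∣d∣≡xn ⟩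
    - + (x ℕ.* n)             ≡⟨ cong -_ (ℤ.pos-* x n) ⟩
    - (+ x * + n)             ≡⟨ ℤ.neg-distribˡ-* (+ x) (+ n) ⟩
    - + x * + n               ∎))
  where
  open ≡-Reasoning
  identity : ∀ y u d → - y * u * d - 1ℤ ≡ - (1ℤ + y * (u * d))
  identity = solve-∀

-- Isomorphism of move graphs.

module _ (n : ℕ) where
  open CommutativeRing (ℤmod n) using (setoid; reflexive; *-congʳ)
    renaming (trans to ≈-trans)
  open MatrixAlgebra (ℤmod n)
  open MatrixProperties (ℤmod n)
  open VectorEquality setoid using (_≋_; ≋-setoid; ≋-trans)

  -- `S *ᵛ_` carries arcs of the graph of `M₂` to arcs of that of `M₁`, so the isomorphism in the
  -- stated direction is its inverse `A *ᵛ_`.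
  intertwined⇒≅ : ∀ {m} (M₁ M₂ S A : Matrix ℤ m) →
    S *ᴹ A ≈ᴹ 1ᴹ → A *ᴹ S ≈ᴹ 1ᴹ → S *ᴹ M₂ ≈ᴹ M₁ *ᴹ S →
    moveGraph M₁ n ≅ moveGraph M₂ n
  intertwined⇒≅ {m} M₁ M₂ S A SA≈1 AS≈1 SM₂≈M₁S = record
    { bijection = Inverse⇒Bijection (record
      { to        = A *ᵛ_
      ; from      = S *ᵛ_
      ; to-cong   = *ᵛ-congˡ A
      ; from-cong = *ᵛ-congˡ S
      ; inverse   = (λ {x} y≈Sx → ≋-trans (*ᵛ-congˡ A y≈Sx) (cancel A S AS≈1 x))
                  , (λ {x} y≈Ax → ≋-trans (*ᵛ-congˡ S y≈Ax) (cancel S A SA≈1 x))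
      })
    ; arcs = λ x y → mk⇔
        (λ y≈M₁x → ≋-trans (*ᵛ-congˡ A y≈M₁x) (AM₁x≈M₂Ax x))
        -- Arcs are reflected because applying `S` undoes `A`.
        (λ Ay≈M₂Ax → begin
          y                      ≈⟨ cancel S A SA≈1 y ⟨
          S *ᵛ (A *ᵛ y)          ≈⟨ *ᵛ-congˡ S Ay≈M₂Ax ⟩
          S *ᵛ (M₂ *ᵛ (A *ᵛ x))  ≈⟨ *ᵛ-congˡ S (AM₁x≈M₂Ax x) ⟨
          S *ᵛ (A *ᵛ (M₁ *ᵛ x))  ≈⟨ cancel S A SA≈1 (M₁ *ᵛ x) ⟩
          M₁ *ᵛ x                ∎)
    }
    where
    open SetoidReasoning (≋-setoid m)
    cancel : ∀ P Q → P *ᴹ Q ≈ᴹ 1ᴹ → ∀ x → P *ᵛ (Q *ᵛ x) ≋ x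
    cancel P Q PQ≈1 x = begin
      P *ᵛ (Q *ᵛ x)  ≈⟨ *ᵛ-assoc P Q x ⟨
      (P *ᴹ Q) *ᵛ x  ≈⟨ *ᵛ-congʳ x PQ≈1 ⟩
      1ᴹ *ᵛ x        ≈⟨ *ᵛ-identityˡ x ⟩
      x              ∎

    AM₁x≈M₂Ax : ∀ x → A *ᵛ (M₁ *ᵛ x) ≋ M₂ *ᵛ (A *ᵛ x)
    AM₁x≈M₂Ax x = begin
      A *ᵛ (M₁ *ᵛ x)  ≈⟨ *ᵛ-assoc A M₁ x ⟨
      (A *ᴹ M₁) *ᵛ x  ≈⟨ *ᵛ-congʳ x (inverse-intertwines (*ᴹ-monoid m)
                            {S} {A} {M₁} {M₂} SA≈1 AS≈1 SM₂≈M₁S) ⟩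
      (M₂ *ᴹ A) *ᵛ x  ≈⟨ *ᵛ-assoc M₂ A x ⟩
      M₂ *ᵛ (A *ᵛ x)  ∎

  -- `ℤmod n` keeps the integer operations and changes only equality, so integer matrix identities
  -- pass to it by `reflexive`. Scaling the adjugate by `u` then absorbs the factor `det S`.
  det-invertible⇒≅ : ∀ {m} (M₁ M₂ S : Matrix ℤ m) → Matℚ.GL (toℚᴹ S) →
    S Matℤ.*ᴹ M₂ Matℤ.≈ᴹ M₁ Matℤ.*ᴹ S →
    ∀ u → (u * Matℤ.det S) ≡ 1ℤ [mod n ] →
    moveGraph M₁ n ≅ moveGraph M₂ n
  det-invertible⇒≅ M₁ M₂ S S∈GL SM₂≈M₁S u ud≈1 =
    intertwined⇒≅ M₁ M₂ S (u ·ᴹ adjugate S)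
      (λ i j → ≈-trans (*ᴹ-·ᴹ u S (adjugate S) i j) (unscale (*-adjugate S i j)))
      (λ i j → ≈-trans (·ᴹ-*ᴹ u (adjugate S) S i j) (unscale (adjugate-* S S∈GL i j)))
      (λ i j → reflexive (SM₂≈M₁S i j))
    where
    unscale : ∀ {x y} → x ≡ Matℤ.det S * y → (u * x) ≡ y [mod n ]
    unscale {x} {y} x≡dy = ≈-trans
      (reflexive (trans (cong (u *_) x≡dy) (sym (ℤ.*-assoc u (Matℤ.det S) y))))
      (≈-trans (*-congʳ ud≈1) (reflexive (ℤ.*-identityˡ y)))

open Matℤ using (det)
open Matℚ using (GL; _≈ᴹ_; _*ᴹ_)

theorem3p5 : (m : ℕ) .{{_ : NonZero m}} (M₁ M₂ S : Matrix ℤ m)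
    (S∈GL : GL (toℚᴹ S)) →
    toℚᴹ M₂ ≈ᴹ (proj₁ S∈GL *ᴹ toℚᴹ M₁) *ᴹ toℚᴹ S →
    (n : ℕ) .{{_ : NonZero n}} →
    gcd (+ n) (det S) ≡ 1ℤ →
    moveGraph M₁ n ≅ moveGraph M₂ n
theorem3p5 m M₁ M₂ S S∈GL M₂≈S⁻¹M₁S n gcd≡1 =
  let u , ud≡1 = coprime⇒invertible n (det S) gcd≡1 in
  det-invertible⇒≅ n M₁ M₂ S S∈GL
    (conjugate⇒intertwines M₁ M₂ S S∈GL M₂≈S⁻¹M₁S) u ud≡1
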